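{- Let $A\in\mathcal{PM}(n)$ have row vectors $r_0,\ldots,r_{n-1}$. A row vector $v\in\{0,1\}^n$ is a poset vector of $A$ if and only if $v=\sum_{i\in S} r_i$ (Boolean sum) for some $S\subseteq X_n$ with $|S|=k\ge 0$ such that the principal submatrix $A[S]$ equals the $k\times k$ identity matrix $I_k$, where the empty sum ($k=0$) is $v=\mathbf{0}$.
   Context: Let $X_n=\{0,1,\ldots,n-1\}$. A naturally labeled (NL) poset on $X_n$ is a partial order $\preceq$ on $X_n$ such that $x\preceq y$ implies $x\le y$ in the usual integer order. Its poset matrix is the $n\times n$ $(0,1)$-matrix $A=(a_{i,j})_{i,j\in X_n}$ with $a_{i,j}=1$ if $j\preceq i$ and $0$ otherwise; $\mathcal{PM}(n)$ is the set of all such matrices. Vectors are over the Boolean algebra $\{0,1\}$ with $0+0=0$, $0+1=1+0=1+1=1$ (entrywise sum). For $v\in\{0,1\}^n$ (a row vector), $A^v=\begin{bmatrix}A&\mathbf{0}\\ v&1\end{bmatrix}$, and $v$ is a poset vector of $A$ if $A^v\in\mathcal{PM}(n+1)$. For $S\subseteq X_n$, $A[S]$ is the principal submatrix of $A$ with rows and columns indexed by $S$. -}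

module Defs where

open import Data.Bool.Base using (Bool; true; false; _∨_)
open import Data.Fin.Base using (Fin; zero; suc; _≤_)
open import Data.Fin.Properties using (_≟_)
open import Data.Fin.Subset using (Subset; inside; outside; ∣_∣)
open import Data.Nat.Base using (ℕ; suc)
open import Data.Product.Base using (Σ-syntax)
open import Data.Vec.Base using (Vec; []; _∷_; _∷ʳ_; map; lookup; tabulate; zipWith; replicate; foldr′)
open import Level using (0ℓ)
open import Relation.Binary.Core using (Rel)
open import Relation.Binary.Definitions using (Decidable)
open import Relation.Binary.PropositionalEquality.Core using (_≡_)
open import Relation.Binary.Structures using (IsPartialOrder)
open import Relation.Nullary.Decidable.Core using (⌊_⌋)

BVec : ℕ → Set
BVec = Vec Bool

-- Square (0,1)-matrices as vectors of rows, with true = 1 and false = 0.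
BMatrix : ℕ → Set
BMatrix n = Vec (BVec n) n

row : ∀ {n} → BMatrix n → Fin n → BVec n
row A i = lookup A i

entry : ∀ {n} → BMatrix n → Fin n → Fin n → Bool
entry A i j = lookup (row A i) j

-- Decidability is what makes "1 if j ≼ i and 0 otherwise" a definition
-- constructively; classically it is no restriction.
record NLPoset (n : ℕ) : Set₁ where
  field
    _≼_            : Rel (Fin n) 0ℓ
    isPartialOrder : IsPartialOrder _≡_ _≼_
    natural        : ∀ {x y} → x ≼ y → x ≤ y
    _≼?_           : Decidable _≼_

posetMatrix : ∀ {n} → NLPoset n → BMatrix n
posetMatrix P = tabulate λ i → tabulate λ j → ⌊ j ≼? i ⌋
  where open NLPoset P

PM : (n : ℕ) → BMatrix n → Set₁
PM n A = Σ[ P ∈ NLPoset n ] A ≡ posetMatrix P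

-- The bordered matrix A^v: a zero column on the right, then the bottom row (v , 1).
_^_ : ∀ {n} → BMatrix n → BVec n → BMatrix (suc n)
A ^ v = map (_∷ʳ false) A ∷ʳ (v ∷ʳ true)

IsPosetVector : ∀ {n} → BMatrix n → BVec n → Set₁
IsPosetVector {n} A v = PM (suc n) (A ^ v)

identity : (k : ℕ) → BMatrix k
identity k = tabulate λ i → tabulate λ j → ⌊ i ≟ j ⌋

-- The elements of S in increasing order.
elements : ∀ {n} (S : Subset n) → Vec (Fin n) ∣ S ∣
elements []            = []
elements (inside  ∷ S) = zero ∷ map suc (elements S)
elements (outside ∷ S) = map suc (elements S)

principalSubmatrix : ∀ {n} → BMatrix n → (S : Subset n) → BMatrix ∣ S ∣
principalSubmatrix A S = map (λ i → map (λ j → entry A i j) (elements S)) (elements S)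

𝟎 : ∀ {n} → BVec n
𝟎 = replicate _ false

_⊕_ : ∀ {n} → BVec n → BVec n → BVec n
_⊕_ = zipWith _∨_

booleanSum : ∀ {m n} → Subset m → (Fin m → BVec n) → BVec n
booleanSum S r = foldr′ _⊕_ 𝟎 (map r (elements S))

{-# OPTIONS --safe #-}

-- Bordering A by v gives a poset matrix exactly when v is the indicator of a
-- down-set of the poset of A. The row r_i is the indicator of the principal
-- down-set of i, and A[S] is an identity matrix exactly when S is an antichain.
-- So a Boolean sum of rows is a down-set, and conversely every down-set is
-- generated by the antichain of its maximal elements.

module Submission where

open import Defs
open import Data.Nat.Base using (ℕ)
open import Data.Fin.Subset using (Subset; ∣_∣)
open import Data.Product.Base using (_×_; Σ-syntax)
open import Function.Bundles using (_⇔_)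
open import Relation.Binary.PropositionalEquality.Core using (_≡_)

open import Data.Bool.Base using (Bool; true; false; _∨_)
open import Data.Bool.Properties using (⇔→≡; ∨-zeroʳ)
import Data.Bool.Properties as Bool
open import Data.Fin.Base using (Fin; zero; suc; _≤_; _>_; inject₁; fromℕ)
open import Data.Fin.Induction using (Acc; acc; >-wellFounded)
open import Data.Fin.Properties using (_≟_; any?; suc-injective; ≤-antisym; ≤∧≢⇒<; ≤fromℕ; toℕ-inject₁)
open import Data.Fin.Relation.Unary.Top using (view; ‵fromℕ; ‵inject₁)
import Data.Nat.Base as ℕ
open import Data.Product.Base using (_,_; ∃; proj₁; proj₂)
open import Data.Vec.Base using (Vec; []; _∷_; _∷ʳ_; map; lookup; tabulate; foldr′)
open import Data.Vec.Properties using (lookup∘tabulate; tabulate∘lookup; tabulate-cong; lookup-map; lookup-zipWith; lookup-replicate)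
open import Function.Base using (_∘_)
open import Function.Bundles using (mk⇔; Equivalence)
open import Relation.Binary.PropositionalEquality using (_≢_; refl; sym; trans; cong; subst₂; isEquivalence)
open import Relation.Binary.Structures using (IsPartialOrder)
open import Relation.Nullary using (Dec; yes; no; ¬_; ¬?; _×-dec_; contradiction)
open import Relation.Nullary.Decidable using (⌊_⌋; decidable-stable)

open Equivalence using (to; from)

private
  variable
    m n : ℕ

-- Extensionality and entries of vectors and matrices.

lookup-extensional : ∀ {X : Set} {xs ys : Vec X n} → (∀ i → lookup xs i ≡ lookup ys i) → xs ≡ ys
lookup-extensional {xs = xs} {ys} eq =
  trans (sym (tabulate∘lookup xs)) (trans (tabulate-cong eq) (tabulate∘lookup ys))

entry-extensional : {A B : BMatrix n} → (∀ i j → entry A i j ≡ entry B i j) → A ≡ B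
entry-extensional eq = lookup-extensional λ i → lookup-extensional (eq i)

entry-tabulate : (f : Fin n → Fin n → Bool) → ∀ i j →
  entry (tabulate λ i → tabulate (f i)) i j ≡ f i j
entry-tabulate f i j =
  trans (cong (λ r → lookup r j) (lookup∘tabulate _ i)) (lookup∘tabulate (f i) j)

lookup-∷ʳ-inject₁ : ∀ {X : Set} (xs : Vec X n) x i → lookup (xs ∷ʳ x) (inject₁ i) ≡ lookup xs i
lookup-∷ʳ-inject₁ (y ∷ xs) x zero    = refl
lookup-∷ʳ-inject₁ (y ∷ xs) x (suc i) = lookup-∷ʳ-inject₁ xs x i

lookup-∷ʳ-fromℕ : ∀ {X : Set} (xs : Vec X n) x → lookup (xs ∷ʳ x) (fromℕ n) ≡ x
lookup-∷ʳ-fromℕ []       x = refl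
lookup-∷ʳ-fromℕ (y ∷ xs) x = lookup-∷ʳ-fromℕ xs x

⌊⌋≡true : ∀ {P : Set} (P? : Dec P) → ⌊ P? ⌋ ≡ true ⇔ P
⌊⌋≡true (yes p) = mk⇔ (λ _ → p) (λ _ → refl)
⌊⌋≡true (no ¬p) = mk⇔ (λ ()) (λ p → contradiction p ¬p)

-- Poset matrices described by their entries.

-- Antisymmetry is implied by lower triangularity.
record IsPosetMatrix (A : BMatrix n) : Set where
  field
    diagonal   : ∀ i → entry A i i ≡ true
    transitive : ∀ {i j k} → entry A i j ≡ true → entry A j k ≡ true → entry A i k ≡ true
    lower      : ∀ {i j} → entry A i j ≡ true → j ≤ i

open IsPosetMatrix

PM⇒IsPosetMatrix : {A : BMatrix n} → PM n A → IsPosetMatrix A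
PM⇒IsPosetMatrix {n} {A} (P , A≡P) = record
  { diagonal   = λ i → from entry⇔≼ P.refl
  -- The arguments swap because `entry A i j` encodes `j ≼ i`, with the row index on top.
  ; transitive = λ p q → from entry⇔≼ (P.trans (to entry⇔≼ q) (to entry⇔≼ p))
  ; lower      = natural ∘ to entry⇔≼
  }
  where
  open NLPoset P
  module P = IsPartialOrder isPartialOrder

  entry⇔≼ : ∀ {i j} → entry A i j ≡ true ⇔ j ≼ i
  entry⇔≼ {i} {j} = mk⇔ (to (⌊⌋≡true (j ≼? i)) ∘ trans (sym eq))
                        (trans eq ∘ from (⌊⌋≡true (j ≼? i)))
    where
    eq : entry A i j ≡ ⌊ j ≼? i ⌋
    eq = trans (cong (λ B → entry B i j) A≡P) (entry-tabulate (λ i j → ⌊ j ≼? i ⌋) i j)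

IsPosetMatrix⇒PM : {A : BMatrix n} → IsPosetMatrix A → PM n A
IsPosetMatrix⇒PM {n} {A} A-pm = P , entry-extensional λ i j →
  -- Two Booleans agree once each is `true` exactly when the other is.
  trans (⇔→≡ {z = true} (mk⇔ (from (⌊⌋≡true (_ Bool.≟ _))) (to (⌊⌋≡true (_ Bool.≟ _)))))
        (sym (entry-tabulate (λ i j → ⌊ entry A i j Bool.≟ true ⌋) i j))
  where
  P : NLPoset n
  P = record
    { _≼_            = λ j i → entry A i j ≡ true
    ; isPartialOrder = record
      { isPreorder = record
        { isEquivalence = isEquivalence
        ; reflexive     = λ { {i} refl → diagonal A-pm i }
        ; trans         = λ p q → transitive A-pm q p
        }
      ; antisym = λ p q → ≤-antisym (lower A-pm p) (lower A-pm q)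
      }
    ; natural = lower A-pm
    ; _≼?_    = λ j i → entry A i j Bool.≟ true
    }

-- Entries of the bordered matrix.

module _ (A : BMatrix n) (v : BVec n) where

  private
    row-inject₁ : ∀ i → row (A ^ v) (inject₁ i) ≡ row A i ∷ʳ false
    row-inject₁ i = trans (lookup-∷ʳ-inject₁ (map (_∷ʳ false) A) _ i) (lookup-map i _ A)

    row-fromℕ : row (A ^ v) (fromℕ n) ≡ v ∷ʳ true
    row-fromℕ = lookup-∷ʳ-fromℕ (map (_∷ʳ false) A) _

  entry-^-inner : ∀ i j → entry (A ^ v) (inject₁ i) (inject₁ j) ≡ entry A i j
  entry-^-inner i j =
    trans (cong (λ r → lookup r (inject₁ j)) (row-inject₁ i)) (lookup-∷ʳ-inject₁ (row A i) _ j)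

  entry-^-column : ∀ i → entry (A ^ v) (inject₁ i) (fromℕ n) ≡ false
  entry-^-column i =
    trans (cong (λ r → lookup r (fromℕ n)) (row-inject₁ i)) (lookup-∷ʳ-fromℕ (row A i) _)

  entry-^-row : ∀ j → entry (A ^ v) (fromℕ n) (inject₁ j) ≡ lookup v j
  entry-^-row j = trans (cong (λ r → lookup r (inject₁ j)) row-fromℕ) (lookup-∷ʳ-inject₁ v _ j)

  entry-^-corner : entry (A ^ v) (fromℕ n) (fromℕ n) ≡ true
  entry-^-corner = trans (cong (λ r → lookup r (fromℕ n)) row-fromℕ) (lookup-∷ʳ-fromℕ v _)

  entry-^-column-≢true : ∀ {i} → entry (A ^ v) (inject₁ i) (fromℕ n) ≢ true
  entry-^-column-≢true {i} p with () ← trans (sym (entry-^-column i)) p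

-- Poset vectors as indicators of down-sets.

IsDownSet : BMatrix n → BVec n → Set
IsDownSet A v = ∀ {i j} → lookup v i ≡ true → entry A i j ≡ true → lookup v j ≡ true

-- This is transitivity of `A ^ v` along the new element, `i`, `j`: the bottom row of `A ^ v`
-- restricts to `v`.
IsPosetVector⇒IsDownSet : {A : BMatrix n} {v : BVec n} → IsPosetVector A v → IsDownSet A v
IsPosetVector⇒IsDownSet {A = A} {v} A^v-pm {i} {j} vᵢ aᵢⱼ =
  trans (sym (entry-^-row A v j))
    (transitive (PM⇒IsPosetMatrix A^v-pm)
      (trans (entry-^-row A v i) vᵢ) (trans (entry-^-inner A v i j) aᵢⱼ))

-- The zero column puts no old element above the new one, so the only chains not already settled by
-- `A` start at the new element.
IsDownSet⇒IsPosetVector : {A : BMatrix n} {v : BVec n} →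
  IsPosetMatrix A → IsDownSet A v → IsPosetVector A v
IsDownSet⇒IsPosetVector {n} {A} {v} A-pm v-down = IsPosetMatrix⇒PM record
  { diagonal   = diag
  ; transitive = λ {i} {j} {k} → tran i j k
  ; lower      = λ {i} {j} → low i j
  }
  where
  diag : ∀ i → entry (A ^ v) i i ≡ true
  diag i with view i
  ... | ‵fromℕ     = entry-^-corner A v
  ... | ‵inject₁ i = trans (entry-^-inner A v i i) (diagonal A-pm i)

  inner : ∀ {i j} → entry (A ^ v) (inject₁ i) (inject₁ j) ≡ true → entry A i j ≡ true
  inner = trans (sym (entry-^-inner A v _ _))

  tran : ∀ i j k → entry (A ^ v) i j ≡ true → entry (A ^ v) j k ≡ true → entry (A ^ v) i k ≡ true
  tran i j k p q with view i | view j | view k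
  ... | ‵fromℕ     | _          | ‵fromℕ     = entry-^-corner A v
  ... | ‵fromℕ     | ‵fromℕ     | ‵inject₁ k = q
  -- The new element lies above `j`, and `j` above `k`: this is exactly closure of `v` downwards.
  ... | ‵fromℕ     | ‵inject₁ j | ‵inject₁ k =
    trans (entry-^-row A v k) (v-down (trans (sym (entry-^-row A v j)) p) (inner q))
  ... | ‵inject₁ i | ‵fromℕ     | _          = contradiction p (entry-^-column-≢true A v)
  ... | ‵inject₁ i | ‵inject₁ j | ‵fromℕ     = contradiction q (entry-^-column-≢true A v)
  ... | ‵inject₁ i | ‵inject₁ j | ‵inject₁ k =
    trans (entry-^-inner A v i k) (transitive A-pm (inner p) (inner q))

  low : ∀ i j → entry (A ^ v) i j ≡ true → j ≤ i
  low i j p with view i | view j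
  ... | ‵fromℕ     | _          = ≤fromℕ j
  ... | ‵inject₁ i | ‵fromℕ     = contradiction p (entry-^-column-≢true A v)
  ... | ‵inject₁ i | ‵inject₁ j =
    subst₂ ℕ._≤_ (sym (toℕ-inject₁ j)) (sym (toℕ-inject₁ i)) (lower A-pm (inner p))

-- Enumeration of a subset.

elements-sound : (S : Subset n) → ∀ a → lookup S (lookup (elements S) a) ≡ true
elements-sound (true  ∷ S) zero    = refl
elements-sound (true  ∷ S) (suc a) =
  trans (cong (lookup (true ∷ S)) (lookup-map a suc (elements S))) (elements-sound S a)
elements-sound (false ∷ S) a       =
  trans (cong (lookup (false ∷ S)) (lookup-map a suc (elements S))) (elements-sound S a)

elements-complete : (S : Subset n) → ∀ {i} → lookup S i ≡ true → ∃ λ a → lookup (elements S) a ≡ i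
elements-complete (true ∷ S) {zero} _ = zero , refl
elements-complete (true ∷ S) {suc i} i∈S =
  let a , eq = elements-complete S i∈S
  in suc a , trans (lookup-map a suc (elements S)) (cong suc eq)
elements-complete (false ∷ S) {suc i} i∈S =
  let a , eq = elements-complete S i∈S
  in a , trans (lookup-map a suc (elements S)) (cong suc eq)

-- Ensures that off-diagonal positions of a principal submatrix compare distinct elements of the
-- poset.
elements-injective : (S : Subset n) → ∀ {a b} → lookup (elements S) a ≡ lookup (elements S) b → a ≡ b
elements-injective (true ∷ S) {zero}  {zero}  _ = refl
elements-injective (true ∷ S) {zero}  {suc b} eq
  with () ← trans eq (lookup-map b suc (elements S))
elements-injective (true ∷ S) {suc a} {zero}  eq
  with () ← trans (sym (lookup-map a suc (elements S))) eq
elements-injective (true ∷ S) {suc a} {suc b} eq =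
  cong suc (elements-injective S (suc-injective
    (trans (sym (lookup-map a suc (elements S))) (trans eq (lookup-map b suc (elements S))))))
elements-injective (false ∷ S) {a} {b} eq =
  elements-injective S (suc-injective
    (trans (sym (lookup-map a suc (elements S))) (trans eq (lookup-map b suc (elements S)))))

-- Boolean sums as unions.

-- Stated for an arbitrary vector of indices so that induction works: the tail of `elements S` need
-- not itself enumerate a subset in the form given by `elements`.
lookup-foldr-⊕ : ∀ {k} (r : Fin m → BVec n) (xs : Vec (Fin m) k) j →
  lookup (foldr′ _⊕_ 𝟎 (map r xs)) j ≡ true ⇔ (∃ λ a → lookup (r (lookup xs a)) j ≡ true)
lookup-foldr-⊕ r [] j = mk⇔ (λ p → contradiction (trans (sym (lookup-replicate j false)) p) λ ()) λ ()
lookup-foldr-⊕ {m} {n} {ℕ.suc k} r (x ∷ xs) j = mk⇔ (find refl ∘ trans (sym eq)) (trans eq ∘ build)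
  where
  rest : BVec n
  rest = foldr′ _⊕_ 𝟎 (map r xs)

  eq : lookup (r x ⊕ rest) j ≡ lookup (r x) j ∨ lookup rest j
  eq = lookup-zipWith _∨_ j (r x) rest

  -- The head's bit is abstracted to `b` with an equation, so that splitting on it still leaves a
  -- proof about `r x`.
  find : ∀ {b} → lookup (r x) j ≡ b → b ∨ lookup rest j ≡ true →
    ∃ λ a → lookup (r (lookup (x ∷ xs) a)) j ≡ true
  find {true}  p _ = zero , p
  find {false} _ q = let a , p = to (lookup-foldr-⊕ r xs j) q in suc a , p

  build : (∃ λ a → lookup (r (lookup (x ∷ xs) a)) j ≡ true) →
    lookup (r x) j ∨ lookup rest j ≡ true
  build (zero  , p) = cong (_∨ lookup rest j) p
  build (suc a , p) =
    trans (cong (lookup (r x) j ∨_) (from (lookup-foldr-⊕ r xs j) (a , p))) (∨-zeroʳ _)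

lookup-booleanSum : (S : Subset m) (r : Fin m → BVec n) → ∀ j →
  lookup (booleanSum S r) j ≡ true ⇔ (∃ λ i → lookup S i ≡ true × lookup (r i) j ≡ true)
lookup-booleanSum S r j = mk⇔
  (λ p → let a , q = to (lookup-foldr-⊕ r (elements S) j) p in _ , elements-sound S a , q)
  λ (i , i∈S , q) → let a , eq = elements-complete S i∈S in
    from (lookup-foldr-⊕ r (elements S) j) (a , trans (cong (λ i → lookup (r i) j) eq) q)

-- An element of the sum lies below some `k` in `S`; by transitivity so does everything beneath it.
booleanSum-isDownSet : {A : BMatrix n} → IsPosetMatrix A → (S : Subset n) →
  IsDownSet A (booleanSum S (row A))
booleanSum-isDownSet {A = A} A-pm S {i} {j} vᵢ aᵢⱼ =
  let k , k∈S , aₖᵢ = to (lookup-booleanSum S (row A) i) vᵢ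
  in from (lookup-booleanSum S (row A) j) (k , k∈S , transitive A-pm aₖᵢ aᵢⱼ)

-- Antichains and identity submatrices.

entry-principalSubmatrix : (A : BMatrix n) (S : Subset n) → ∀ a b →
  entry (principalSubmatrix A S) a b ≡ entry A (lookup (elements S) a) (lookup (elements S) b)
entry-principalSubmatrix A S a b =
  trans (cong (λ r → lookup r b) (lookup-map a _ (elements S))) (lookup-map b _ (elements S))

IsAntichain : BMatrix n → Subset n → Set
IsAntichain A S = ∀ {i j} → lookup S i ≡ true → lookup S j ≡ true → entry A i j ≡ true → i ≡ j

-- Reflexivity gives the ones on the diagonal; the antichain condition and injectivity of the
-- enumeration exclude any other.
antichain⇒identity : {A : BMatrix n} → IsPosetMatrix A → (S : Subset n) → IsAntichain A S →
  principalSubmatrix A S ≡ identity ∣ S ∣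
antichain⇒identity {A = A} A-pm S S-anti = entry-extensional λ a b →
  trans (entry-principalSubmatrix A S a b)
    (trans (⇔→≡ {z = true} (mk⇔ (from (⌊⌋≡true (a ≟ b)) ∘ related⇒≡) (≡⇒related ∘ to (⌊⌋≡true (a ≟ b)))))
      (sym (entry-tabulate (λ i j → ⌊ i ≟ j ⌋) a b)))
  where
  related⇒≡ : ∀ {a b} → entry A (lookup (elements S) a) (lookup (elements S) b) ≡ true → a ≡ b
  related⇒≡ p = elements-injective S (S-anti (elements-sound S _) (elements-sound S _) p)

  ≡⇒related : ∀ {a b} → a ≡ b → entry A (lookup (elements S) a) (lookup (elements S) b) ≡ true
  ≡⇒related refl = diagonal A-pm _

-- The maximal elements of a down-set.

module MaximalElements {A : BMatrix n} (A-pm : IsPosetMatrix A) (v : BVec n) where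

  -- The upper element `j` must lie in `v`, which makes maximality relative to the set that `v`
  -- indicates.
  StrictlyBelow : Fin n → Fin n → Set
  StrictlyBelow i j = lookup v j ≡ true × entry A j i ≡ true × i ≢ j

  strictlyBelow? : ∀ i → Dec (∃ (StrictlyBelow i))
  strictlyBelow? i = any? λ j → (lookup v j Bool.≟ true) ×-dec (entry A j i Bool.≟ true) ×-dec ¬? (i ≟ j)

  IsMaximal : Fin n → Set
  IsMaximal i = lookup v i ≡ true × ¬ ∃ (StrictlyBelow i)

  isMaximal? : ∀ i → Dec (IsMaximal i)
  isMaximal? i = (lookup v i Bool.≟ true) ×-dec ¬? (strictlyBelow? i)

  maximals : Subset n
  maximals = tabulate λ i → ⌊ isMaximal? i ⌋

  lookup-maximals : ∀ i → lookup maximals i ≡ true ⇔ IsMaximal i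
  lookup-maximals i = mk⇔
    (to (⌊⌋≡true (isMaximal? i)) ∘ trans (sym (lookup∘tabulate _ i)))
    (trans (lookup∘tabulate _ i) ∘ from (⌊⌋≡true (isMaximal? i)))

  maximals-isAntichain : IsAntichain A maximals
  maximals-isAntichain {i} {j} i∈M j∈M aᵢⱼ = sym (decidable-stable (j ≟ i) λ j≢i →
    -- Otherwise `i` would be an element of `v` strictly above the maximal element `j`.
    proj₂ (to (lookup-maximals j) j∈M) (i , proj₁ (to (lookup-maximals i) i∈M) , aᵢⱼ , j≢i))

  -- While the current element is not maximal, climb to one strictly above it in `v`. By natural
  -- labeling each climb increases the integer label, so well-foundedness of `_>_` on `Fin n` ends
  -- the ascent.
  below-maximal : ∀ i → lookup v i ≡ true → ∃ λ k → IsMaximal k × entry A k i ≡ true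
  below-maximal i = climb (>-wellFounded i)
    where
    climb : ∀ {i} → Acc _>_ i → lookup v i ≡ true → ∃ λ k → IsMaximal k × entry A k i ≡ true
    climb {i} (acc rec) vᵢ with strictlyBelow? i
    ... | no  top                    = i , (vᵢ , top) , diagonal A-pm i
    ... | yes (j , vⱼ , aⱼᵢ , i≢j) =
      let k , k-max , aₖⱼ = climb (rec (≤∧≢⇒< (lower A-pm aⱼᵢ) i≢j)) vⱼ
      in k , k-max , transitive A-pm aₖⱼ aⱼᵢ

  -- Each element of `v` lies below a maximal one; conversely, whatever lies below a maximal element
  -- is in `v` by downward closure.
  booleanSum-maximals : IsDownSet A v → v ≡ booleanSum maximals (row A)
  booleanSum-maximals v-down = lookup-extensional λ i → ⇔→≡ {z = true} (mk⇔
    (λ vᵢ → let k , k-max , aₖᵢ = below-maximal i vᵢ in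
      from (lookup-booleanSum maximals (row A) i) (k , from (lookup-maximals k) k-max , aₖᵢ))
    λ p → let k , k∈M , aₖᵢ = to (lookup-booleanSum maximals (row A) i) p in
      v-down (proj₁ (to (lookup-maximals k) k∈M)) aₖᵢ)

theorem2p2 : (n : ℕ) (A : BMatrix n) → PM n A → (v : BVec n) →
    IsPosetVector A v ⇔
    (Σ[ S ∈ Subset n ] (principalSubmatrix A S ≡ identity ∣ S ∣ × v ≡ booleanSum S (row A)))
theorem2p2 n A A∈PM v = mk⇔
  (λ v-pv → maximals , antichain⇒identity A-pm maximals maximals-isAntichain
                     , booleanSum-maximals (IsPosetVector⇒IsDownSet v-pv))
  -- Matching on `refl` replaces `v` by the Boolean sum, which is a down-set.
  λ { (S , _ , refl) → IsDownSet⇒IsPosetVector A-pm (booleanSum-isDownSet A-pm S) }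
  where
  A-pm = PM⇒IsPosetMatrix A∈PM
  open MaximalElements A-pm v
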